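{- Let $(\Omega,S)$ be a scheme such that for each $\alpha\in\Omega$ the $\alpha$-extension $(\Omega,S_\alpha)$ is semiregular on $\Omega\setminus\{\alpha\}$ and its fibers are the sets $\alpha s$, $s\in S$. Then $(\Omega,S)$ is a regular scheme or a Frobenius scheme.
   Context: A coherent configuration on a finite set $\Omega$ is a pair $(\Omega,T)$, $T$ a partition of $\Omega\times\Omega$, such that $1_\Omega$ is a union of elements of $T$, $T$ is closed under transposition, and $c_{rs}^t=|\{\beta:(\alpha,\beta)\in r,(\beta,\gamma)\in s\}|$ is independent of $(\alpha,\gamma)\in t$. Fibers are sets $\Delta$ with $1_\Delta\in T$. A scheme is a coherent configuration $(\Omega,S)$ with $1_\Omega\in S$; $\alpha s=\{\beta:(\alpha,\beta)\in s\}$. The $\alpha$-extension is the coarsest coherent configuration $(\Omega,S_\alpha)$ such that $\{(\alpha,\alpha)\}\in S_\alpha$ and every $s\in S$ is a union of elements of $S_\alpha$. It is semiregular on $\Omega\setminus\{\alpha\}$ if $|\beta s|\le1$ for all $\beta\ne\alpha$ and all $s\in S_\alpha$ with $s\subseteq(\Omega\setminus\{\alpha\})^2$. A scheme is regular if $|\alpha s|\le1$ for all $\alpha,s$. A Frobenius group is a non-regular transitive permutation group with all two-point stabilizers trivial; a Frobenius scheme is the scheme whose basis relations are the orbits of a Frobenius group on $\Omega\times\Omega$. -}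

module Defs where

open import Data.Nat using (ℕ; _≤_)
open import Data.Nat.Properties using (_≟_)
open import Data.Fin using (Fin)
import Data.Fin.Properties as FinP
open import Data.Fin.Permutation using (Permutation′; _⟨$⟩ʳ_; id; flip; _∘ₚ_)
open import Data.List using (List; length; filter)
open import Data.List.Base using (allFin)
open import Data.Product using (Σ; _×_; _,_; ∃)
open import Data.Sum using (_⊎_)
open import Relation.Nullary using (¬_)
open import Relation.Nullary.Decidable using (_×-dec_)
open import Relation.Binary.PropositionalEquality using (_≡_; _≢_)
open import Function.Bundles using (_⇔_)

-- A partition T of Ω × Ω, Ω = Fin n, is given by a colouring
-- c : Fin n → Fin n → ℕ ; the elements of T (basis relations) are the
-- nonempty colour classes { (x , y) | c x y ≡ i }.
Colouring : ℕ → Set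
Colouring n = Fin n → Fin n → ℕ

module _ {n : ℕ} where

  interNum : Colouring n → ℕ → ℕ → Fin n → Fin n → ℕ
  interNum c r s α γ =
    length (filter (λ β → (c α β ≟ r) ×-dec (c β γ ≟ s)) (allFin n))

  record IsCoherent (c : Colouring n) : Set where
    field
      diagonal : ∀ α β γ → c α α ≡ c β γ → β ≡ γ
      transpose : ∀ α β γ δ → c α β ≡ c γ δ → c β α ≡ c δ γ
      intersection : ∀ α γ α′ γ′ → c α γ ≡ c α′ γ′ →
                     ∀ r s → interNum c r s α γ ≡ interNum c r s α′ γ′

  record IsScheme (c : Colouring n) : Set where
    field
      coherent : IsCoherent c
      reflexive : ∀ α β → c α α ≡ c β β

  Refines : Colouring n → Colouring n → Set
  Refines c′ c = ∀ x y u v → c′ x y ≡ c′ u v → c x y ≡ c u v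

  IsPointExtensionCandidate : Colouring n → Fin n → Colouring n → Set
  IsPointExtensionCandidate c α c′ =
    IsCoherent c′ ×
    (∀ x y → (c′ x y ≡ c′ α α) ⇔ (x ≡ α × y ≡ α)) ×
    Refines c′ c

  IsAlphaExtension : Colouring n → Fin n → Colouring n → Set
  IsAlphaExtension c α c′ =
    IsPointExtensionCandidate c α c′ ×
    (∀ (c″ : Colouring n) → IsPointExtensionCandidate c α c″ → Refines c″ c′)

  -- (Ω , S_α) is semiregular on Ω ∖ {α}: for each basis relation s ⊆ (Ω∖{α})²
  -- (namely the class of (β , β₁)) and each β ≠ α, | β s | ≤ 1
  SemiregularOff : Colouring n → Fin n → Set
  SemiregularOff c′ α =
    ∀ β β₁ β₂ →
      (∀ x y → c′ x y ≡ c′ β β₁ → x ≢ α × y ≢ α) →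
      β ≢ α → c′ β β₂ ≡ c′ β β₁ → β₁ ≡ β₂

  -- the fibers of c′ are exactly the sets α s, s ∈ S (both families partition
  -- Ω, so this says the two partitions coincide)
  FibersAreNeighbourhoods : Colouring n → Fin n → Colouring n → Set
  FibersAreNeighbourhoods c α c′ =
    ∀ β γ → (c′ β β ≡ c′ γ γ) ⇔ (c α β ≡ c α γ)

  IsRegularScheme : Colouring n → Set
  IsRegularScheme c = IsScheme c × (∀ α β γ → c α β ≡ c α γ → β ≡ γ)

  record IsPermGroup (G : Permutation′ n → Set) : Set where
    field
      has-id : G id
      closed-∘ : ∀ g h → G g → G h → G (g ∘ₚ h)
      closed-inv : ∀ g → G g → G (flip g)

  FixesAll : Permutation′ n → Set
  FixesAll g = ∀ x → g ⟨$⟩ʳ x ≡ x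

  record IsFrobeniusGroup (G : Permutation′ n → Set) : Set where
    field
      group : IsPermGroup G
      transitive : ∀ α β → ∃ λ g → G g × g ⟨$⟩ʳ α ≡ β
      -- non-regular (given transitivity): some point stabiliser is nontrivial
      nonRegular : ¬ (∀ g → G g → ∀ α → g ⟨$⟩ʳ α ≡ α → FixesAll g)
      twoPoint : ∀ g → G g → ∀ α β → α ≢ β →
                 g ⟨$⟩ʳ α ≡ α → g ⟨$⟩ʳ β ≡ β → FixesAll g

  IsFrobeniusScheme : Colouring n → Set₁
  IsFrobeniusScheme c =
    Σ (Permutation′ n → Set) λ G →
      IsFrobeniusGroup G ×
      (∀ x y u v → (c x y ≡ c u v) ⇔
         (∃ λ g → G g × g ⟨$⟩ʳ x ≡ u × g ⟨$⟩ʳ y ≡ v))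

{-# OPTIONS --safe #-}
module Submission where

-- The α-extension is the limit of Weisfeiler–Leman refinement, so every automorphism of the
-- scheme fixing α preserves each of its colours. By semiregularity a point β ≠ α has at most
-- one neighbour of each colour; hence points β, β′ of one set αs determine an automorphism
-- γ ↦ γ′ by c′(β,γ) = c′(β′,γ′), and only the identity fixes α and β. The same matching
-- argument shows that all αs ≠ {α} have one size k. Every orbit O of the automorphism group
-- is, off a point α, a union of such sets, so |O| ≡ 1 mod k if α ∈ O and |O| ≡ 0 mod k
-- otherwise. If k > 1, there is therefore only one orbit.

open import Defs
open import Data.Bool.Properties using () renaming (_≟_ to _≟ᵇ_)
open import Data.Empty using (⊥-elim)
open import Data.Fin using (Fin; toℕ; finToFun; funToFin)
import Data.Fin.Properties as Fin
open import Data.Fin.Permutation using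
  (Permutation′; permutation; _⟨$⟩ʳ_; _⟨$⟩ˡ_; id; flip; _∘ₚ_; inverseˡ; inverseʳ)
open import Data.List using
  (List; []; _∷_; _++_; length; filter; map; allFin; cartesianProduct; cartesianProductWith)
import Data.List.Properties as List
open import Data.List.Membership.Propositional using (_∈_)
open import Data.List.Membership.Propositional.Properties using
  (∈-∃++; ∈-allFin; ∈-filter⁺; ∈-filter⁻; ∈-cartesianProduct⁺; ∈-cartesianProductWith⁺)
import Data.List.Membership.DecPropositional as DecMembership
import Data.List.Membership.Setoid.Properties as Membership
open import Data.List.Relation.Binary.Permutation.Propositional using
  (_↭_; ↭-refl; ↭-prep; ↭-sym; ↭-trans)
open import Data.List.Relation.Binary.Permutation.Propositional.Properties using
  (shift; ↭-length; ∈-resp-↭; filter-↭)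
import Data.List.Relation.Unary.All as All
open import Data.List.Relation.Unary.AllPairs using ([]; _∷_)
open import Data.List.Relation.Unary.Any as Any using (here; there; index)
open import Data.List.Relation.Unary.Unique.Propositional using (Unique)
open import Data.List.Relation.Unary.Unique.Propositional.Properties using (allFin⁺; filter⁺)
open import Data.Nat using (ℕ; suc; _+_; _≤_; _<_; z≤n; s≤s)
open import Data.Nat.Divisibility using (_∣_; _∣0; ∣m∣n⇒∣m+n; ∣m+n∣m⇒∣n; ∣-reflexive; ∣1⇒≡1)
open import Data.Nat.Induction using (<-wellFounded)
open import Data.Nat.Properties using (_≟_; ≤-antisym; ≤∧≢⇒<; suc-injective; +-comm; +-suc)
open import Data.Product using (_×_; ∃; ∃₂; _,_; proj₁; proj₂)
open import Data.Product.Properties using () renaming (≡-dec to ×-≡-dec)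
open import Data.Sum using (_⊎_; inj₁; inj₂)
open import Function using (_∘_)
open import Function.Bundles using (_⇔_; mk⇔; Equivalence)
open import Induction.WellFounded using (Acc; acc)
open import Relation.Binary.Definitions using (DecidableEquality)
open import Relation.Binary.PropositionalEquality using
  (_≡_; _≢_; refl; sym; trans; cong; cong₂; subst; subst₂; setoid)
open import Relation.Nullary using (¬_; Dec; yes; no; does; proof)
open import Relation.Nullary.Decidable using
  (_×-dec_; ¬?; map′; decidable-stable; does-⇔; dec-true)
open import Relation.Nullary.Reflects using (Reflects; invert)
open import Relation.Unary using (Decidable)

open Equivalence using (to; from)

-- Counting in lists

module _ {A : Set} {P : A → Set} (P? : Decidable P) where

  filter-nonempty : ∀ xs → 0 < length (filter P? xs) → ∃ λ x → x ∈ xs × P x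
  filter-nonempty xs pos with filter P? xs in eq
  ... | a ∷ _ = a , ∈-filter⁻ P? {xs = xs} (subst (a ∈_) (sym eq) (here refl))

  length-filter-map : {B : Set} (f : B → A) (xs : List B) →
    length (filter P? (map f xs)) ≡ length (filter (λ x → P? (f x)) xs)
  length-filter-map f [] = refl
  length-filter-map f (x ∷ xs) with P? (f x)
  ... | yes _ = cong suc (length-filter-map f xs)
  ... | no _ = length-filter-map f xs

  length-filter-split : ∀ xs →
    length (filter P? xs) + length (filter (λ x → ¬? (P? x)) xs) ≡ length xs
  length-filter-split [] = refl
  length-filter-split (x ∷ xs) with P? x
  ... | yes _ = cong suc (length-filter-split xs)
  ... | no _ = trans (+-suc _ _) (cong suc (length-filter-split xs))

module _ {A : Set} {P Q : A → Set} (P? : Decidable P) (Q? : Decidable Q) where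

  filter-filter : ∀ xs → filter P? (filter Q? xs) ≡ filter (λ x → P? x ×-dec Q? x) xs
  filter-filter [] = refl
  filter-filter (x ∷ xs) with Q? x
  ... | yes _ with P? x
  ...   | yes _ = cong (x ∷_) (filter-filter xs)
  ...   | no _ = filter-filter xs
  filter-filter (x ∷ xs) | no _ with P? x
  ...   | yes _ = filter-filter xs
  ...   | no _ = filter-filter xs

  filter-absorb : ∀ xs → (∀ x → P x → Q x) → filter P? (filter Q? xs) ≡ filter P? xs
  filter-absorb xs sub = trans (filter-filter xs)
    (List.filter-≐ _ P? (proj₁ , (λ p → p , sub _ p)) xs)

  filter-⊆-≤ : ∀ xs → (∀ x → P x → Q x) → length (filter P? xs) ≤ length (filter Q? xs)
  filter-⊆-≤ xs sub = subst (λ l → length l ≤ length (filter Q? xs))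
    (filter-absorb xs sub) (List.length-filter P? (filter Q? xs))

  -- A filtered sublist as long as its list is the whole list. Refinement is later seen to have
  -- stabilised in this way.
  filter-⊆-≡ : ∀ xs → (∀ x → P x → Q x) → length (filter P? xs) ≡ length (filter Q? xs) →
    ∀ {x} → x ∈ xs → Q x → P x
  filter-⊆-≡ xs sub eq {x} x∈ q =
    proj₂ (∈-filter⁻ P? {xs = filter Q? xs} (subst (x ∈_) (sym complete) (∈-filter⁺ Q? x∈ q)))
    where
    complete : filter P? (filter Q? xs) ≡ filter Q? xs
    complete = List.filter-complete P? (trans (cong length (filter-absorb xs sub)) eq)

-- Each `x` takes its partner out of `ys`; by `inj` no later element has the same partner, so the
-- shortened list still serves the rest.
length-≤-by-injection : {A B : Set} (R : A → B → Set) →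
  (∀ {x x′ y} → R x y → R x′ y → x ≡ x′) →
  ∀ {xs ys} → Unique xs → (∀ {x} → x ∈ xs → ∃ λ y → y ∈ ys × R x y) →
  length xs ≤ length ys
length-≤-by-injection R inj [] _ = z≤n
length-≤-by-injection R inj {x ∷ xs} (x∉xs ∷ u) f with f (here refl)
... | y , y∈ys , xRy with ∈-∃++ y∈ys
... | as , bs , refl =
  subst (suc (length xs) ≤_) (sym (↭-length (shift y as bs)))
    (s≤s (length-≤-by-injection R inj u g))
  where
  g : ∀ {x′} → x′ ∈ xs → ∃ λ y′ → y′ ∈ as ++ bs × R x′ y′
  g x′∈xs with f (there x′∈xs)
  ... | y′ , y′∈ , x′Ry′ with ∈-resp-↭ (shift y as bs) y′∈
  ...   | here refl = ⊥-elim (All.lookup x∉xs x′∈xs (inj xRy x′Ry′))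
  ...   | there y′∈′ = y′ , y′∈′ , x′Ry′

count-≤ : ∀ {m n} {P : Fin m → Set} {Q : Fin n → Set} (P? : Decidable P) (Q? : Decidable Q)
  (R : Fin m → Fin n → Set) → (∀ {x x′ y} → R x y → R x′ y → x ≡ x′) →
  (∀ x → P x → ∃ λ y → Q y × R x y) →
  length (filter P? (allFin m)) ≤ length (filter Q? (allFin n))
count-≤ {m} P? Q? R inj f = length-≤-by-injection R inj (filter⁺ P? (allFin⁺ m)) g
  where
  g : ∀ {x} → x ∈ filter P? (allFin m) → ∃ λ y → y ∈ filter Q? (allFin _) × R x y
  g x∈ with f _ (proj₂ (∈-filter⁻ P? {xs = allFin m} x∈))
  ... | y , q , r = y , ∈-filter⁺ Q? (∈-allFin y) q , r

module _ {A : Set} (_≟ᴬ_ : DecidableEquality A) where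

  equal-counts⇒↭ : ∀ xs ys →
    (∀ a → length (filter (_≟ᴬ a) xs) ≡ length (filter (_≟ᴬ a) ys)) → xs ↭ ys
  equal-counts⇒↭ [] [] _ = ↭-refl
  equal-counts⇒↭ [] (y ∷ ys) eq
    with () ← trans (eq y) (cong length (List.filter-accept (_≟ᴬ y) {xs = ys} refl))
  equal-counts⇒↭ (x ∷ xs) ys eq
    with filter-nonempty (_≟ᴬ x) ys (subst (0 <_) (trans
           (sym (cong length (List.filter-accept (_≟ᴬ x) {xs = xs} refl))) (eq x)) (s≤s z≤n))
  ... | .x , x∈ys , refl with ∈-∃++ x∈ys
  ... | as , bs , refl =
    ↭-trans (↭-prep x (equal-counts⇒↭ xs (as ++ bs) eq′)) (↭-sym (shift x as bs))
    where
    eq″ : ∀ a → length (filter (_≟ᴬ a) (x ∷ xs)) ≡ length (filter (_≟ᴬ a) (x ∷ as ++ bs))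
    eq″ a = trans (eq a) (↭-length (filter-↭ (_≟ᴬ a) (shift x as bs)))
    eq′ : ∀ a → length (filter (_≟ᴬ a) xs) ≡ length (filter (_≟ᴬ a) (as ++ bs))
    eq′ a with x ≟ᴬ a | eq″ a
    ... | yes _ | e = suc-injective e
    ... | no _  | e = e

-- Split off the class of the first element. The other classes lie wholly in `rest`, so they keep
-- their size `k` there.
∣-length-of-classes : {A : Set} (f : A → ℕ) (k : ℕ) (xs : List A) →
  (∀ x → x ∈ xs → length (filter (λ y → f y ≟ f x) xs) ≡ k) → k ∣ length xs
∣-length-of-classes {A} f k xs = go xs (<-wellFounded (length xs))
  where
  go : ∀ xs → Acc _<_ (length xs) →
       (∀ x → x ∈ xs → length (filter (λ y → f y ≟ f x) xs) ≡ k) → k ∣ length xs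
  go [] _ _ = k ∣0
  go xs₀@(x ∷ xs) (acc rec) eq =
    subst (k ∣_) (length-filter-split same? xs₀)
      (∣m∣n⇒∣m+n (∣-reflexive (sym (eq x (here refl)))) (go rest (rec shorter) eq′))
    where
    same? = λ y → f y ≟ f x
    other? = λ y → ¬? (same? y)
    rest = filter other? xs₀
    shorter : length rest < length xs₀
    shorter = List.filter-notAll other? xs₀ (here (λ ¬e → ¬e refl))
    eq′ : ∀ y → y ∈ rest → length (filter (λ z → f z ≟ f y) rest) ≡ k
    eq′ y y∈ with ∈-filter⁻ other? {xs = xs₀} y∈
    ... | y∈xs , fy≢fx = trans
      (cong length (filter-absorb (λ z → f z ≟ f y) other? xs₀
        (λ z fz≡fy fz≡fx → fy≢fx (trans (sym fz≡fy) fz≡fx))))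
      (eq y y∈xs)

map-≡⇒≗ : {A B : Set} {f g : A → B} {xs : List A} → map f xs ≡ map g xs →
  ∀ {x} → x ∈ xs → f x ≡ g x
map-≡⇒≗ {xs = _ ∷ _} eq (here refl) = List.∷-injectiveˡ eq
map-≡⇒≗ {xs = _ ∷ _} eq (there x∈) = map-≡⇒≗ (List.∷-injectiveʳ eq) x∈

-- Automorphisms, and intersection numbers under refinement

module _ {n : ℕ} where

  Automorphism : Colouring n → Permutation′ n → Set
  Automorphism c g = ∀ x y → c (g ⟨$⟩ʳ x) (g ⟨$⟩ʳ y) ≡ c x y

  flip-automorphism : ∀ {c} g → Automorphism c g → Automorphism c (flip g)
  flip-automorphism {c} g aut x y =
    trans (sym (aut (g ⟨$⟩ˡ x) (g ⟨$⟩ˡ y))) (cong₂ c (inverseʳ g) (inverseʳ g))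

  flip-fixes : ∀ (g : Permutation′ n) {α β} → g ⟨$⟩ʳ α ≡ β → flip g ⟨$⟩ʳ β ≡ α
  flip-fixes g refl = inverseˡ g

  interNum-automorphism-≤ : ∀ (c : Colouring n) g → Automorphism c g → ∀ r s x y →
    interNum c r s x y ≤ interNum c r s (g ⟨$⟩ʳ x) (g ⟨$⟩ʳ y)
  interNum-automorphism-≤ c g aut r s x y = count-≤ _ _ (λ z w → g ⟨$⟩ʳ z ≡ w)
    (λ e e′ → trans (sym (inverseˡ g)) (trans (cong (g ⟨$⟩ˡ_) (trans e (sym e′))) (inverseˡ g)))
    (λ z (p , q) → g ⟨$⟩ʳ z , (trans (aut x z) p , trans (aut z y) q) , refl)

  -- `g` maps intermediate points injectively to intermediate points, which gives one inequality;
  -- the same for `flip g` gives the other.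
  interNum-automorphism : ∀ (c : Colouring n) g → Automorphism c g → ∀ r s x y →
    interNum c r s (g ⟨$⟩ʳ x) (g ⟨$⟩ʳ y) ≡ interNum c r s x y
  interNum-automorphism c g aut r s x y = ≤-antisym
    (subst₂ (λ u v → interNum c r s (g ⟨$⟩ʳ x) (g ⟨$⟩ʳ y) ≤ interNum c r s u v)
      (inverseˡ g) (inverseˡ g)
      (interNum-automorphism-≤ c (flip g) (flip-automorphism g aut) r s (g ⟨$⟩ʳ x) (g ⟨$⟩ʳ y)))
    (interNum-automorphism-≤ c g aut r s x y)

  refines⇒factors : ∀ (d c : Colouring n) → Refines d c → ∃ λ h → ∀ x y → c x y ≡ h (d x y)
  refines⇒factors d c ref = h , h-spec
    where
    preimage? : ∀ m → Dec (∃₂ λ a b → d a b ≡ m)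
    preimage? m = Fin.any? (λ a → Fin.any? (λ b → d a b ≟ m))
    h : ℕ → ℕ
    h m with preimage? m
    ... | yes (a , b , _) = c a b
    -- Arbitrary value: `h` matters only on colours that `d` attains.
    ... | no _ = 0
    h-spec : ∀ x y → c x y ≡ h (d x y)
    h-spec x y with preimage? (d x y)
    ... | yes (a , b , e) = ref x y a b (sym e)
    ... | no ¬e = ⊥-elim (¬e (x , y , refl))

  -- Coherence of `d` makes the multisets of `d`-colour pairs along paths from `x` to `y` and from
  -- `u` to `v` agree. As `c` factors through `d`, its counts can be read off these multisets.
  interNum-refines : ∀ (d c : Colouring n) → IsCoherent d → Refines d c →
    ∀ x y u v → d x y ≡ d u v → ∀ r s → interNum c r s x y ≡ interNum c r s u v
  interNum-refines d c coh ref x y u v eq r s with refines⇒factors d c ref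
  ... | h , spec = trans (via-keys x y) (trans
          (↭-length (filter-↭ good? (equal-counts⇒↭ _≟²_ (keys x y) (keys u v) counts)))
          (sym (via-keys u v)))
    where
    _≟²_ : DecidableEquality (ℕ × ℕ)
    _≟²_ = ×-≡-dec _≟_ _≟_
    keys : Fin n → Fin n → List (ℕ × ℕ)
    keys a b = map (λ z → d a z , d z b) (allFin n)
    good? : Decidable (λ (pq : ℕ × ℕ) → h (proj₁ pq) ≡ r × h (proj₂ pq) ≡ s)
    good? pq = (h (proj₁ pq) ≟ r) ×-dec (h (proj₂ pq) ≟ s)
    via-keys : ∀ a b → interNum c r s a b ≡ length (filter good? (keys a b))
    via-keys a b = trans
      (cong length (List.filter-≐ _ (λ z → good? (d a z , d z b))
        ( (λ {z} (p , q) → trans (sym (spec a z)) p , trans (sym (spec z b)) q)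
        , (λ {z} (p , q) → trans (spec a z) p , trans (spec z b) q))
        (allFin n)))
      (sym (length-filter-map good? _ (allFin n)))
    count-key : ∀ a b p q → length (filter (_≟² (p , q)) (keys a b)) ≡ interNum d p q a b
    count-key a b p q = trans (length-filter-map (_≟² (p , q)) _ (allFin n))
      (cong length (List.filter-≐ _ _
        ((λ { refl → refl , refl }) , (λ { (refl , refl) → refl })) (allFin n)))
    counts : ∀ pq → length (filter (_≟² pq) (keys x y)) ≡ length (filter (_≟² pq) (keys u v))
    counts (p , q) = trans (count-key x y p q)
      (trans (IsCoherent.intersection coh x y u v eq p q) (sym (count-key u v p q)))

  -- Colourings from keys, and Weisfeiler–Leman refinement

  -- Colours are natural numbers, so a structured key is replaced by a position in the list of all
  -- attained keys.
  module Keyed {K : Set} (_≟ᴷ_ : DecidableEquality K) (key : Fin n → Fin n → K) where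
    open DecMembership _≟ᴷ_ using (_∈?_)

    keys : List K
    keys = cartesianProductWith key (allFin n) (allFin n)

    rank : K → ℕ
    rank k with k ∈? keys
    ... | yes k∈ = toℕ (index k∈)
    ... | no _ = 0

    rank-injective : ∀ {k l} → k ∈ keys → l ∈ keys → rank k ≡ rank l → k ≡ l
    rank-injective {k} {l} k∈ l∈ eq with k ∈? keys | l ∈? keys
    ... | yes p | yes q = Membership.index-injective (setoid K) p q (Fin.toℕ-injective eq)
    ... | no k∉ | _ = ⊥-elim (k∉ k∈)
    ... | yes _ | no l∉ = ⊥-elim (l∉ l∈)

    colouring : Colouring n
    colouring x y = rank (key x y)

    colouring-injective : ∀ x y u v → colouring x y ≡ colouring u v → key x y ≡ key u v
    colouring-injective x y u v = rank-injective (mem x y) (mem u v)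
      where
      mem : ∀ a b → key a b ∈ keys
      mem a b = ∈-cartesianProductWith⁺ key (∈-allFin a) (∈-allFin b)

  colours : Colouring n → List ℕ
  colours c = cartesianProductWith c (allFin n) (allFin n)

  ∈-colours : ∀ c x y → c x y ∈ colours c
  ∈-colours c x y = ∈-cartesianProductWith⁺ c (∈-allFin x) (∈-allFin y)

  interNum-∉-colours : ∀ c r s x y → ¬ (r ∈ colours c × s ∈ colours c) → interNum c r s x y ≡ 0
  interNum-∉-colours c r s x y ∉cs = cong length (List.filter-none _ {xs = allFin n}
    (All.tabulate λ {z} _ (p , q) →
      ∉cs (subst (_∈ colours c) p (∈-colours c x z) , subst (_∈ colours c) q (∈-colours c z y))))

  -- A finite list suffices: an unattained colour gives intersection number 0. The index list
  -- depends on `c` alone, so tables at different pairs compare entry by entry.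
  intersectionTable : Colouring n → Fin n → Fin n → List ℕ
  intersectionTable c x y =
    map (λ rs → interNum c (proj₁ rs) (proj₂ rs) x y) (cartesianProduct (colours c) (colours c))

  intersectionTable-≡ : ∀ c {x y u v} → intersectionTable c x y ≡ intersectionTable c u v →
    ∀ r s → interNum c r s x y ≡ interNum c r s u v
  intersectionTable-≡ c {x} {y} {u} {v} eq r s
    with (r ∈? colours c) ×-dec (s ∈? colours c)
    where open DecMembership _≟_ using (_∈?_)
  ... | yes (r∈ , s∈) = map-≡⇒≗ eq (∈-cartesianProduct⁺ r∈ s∈)
  ... | no ∉cs = trans (interNum-∉-colours c r s x y ∉cs) (sym (interNum-∉-colours c r s u v ∉cs))

  -- One component for each purpose: the first makes the new colouring refine `c`; once stable, the
  -- second yields closure under transposition and the third constant intersection numbers.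
  refinementKey : Colouring n → Fin n → Fin n → ℕ × ℕ × List ℕ
  refinementKey c x y = c x y , c y x , intersectionTable c x y

  module Refinement (c : Colouring n) =
    Keyed (×-≡-dec _≟_ (×-≡-dec _≟_ (List.≡-dec _≟_))) (refinementKey c)

  refine : Colouring n → Colouring n
  refine = Refinement.colouring

  refinementKey-≡ : ∀ c x y u v → refine c x y ≡ refine c u v →
    refinementKey c x y ≡ refinementKey c u v
  refinementKey-≡ c = Refinement.colouring-injective c

  refine-refines : ∀ c → Refines (refine c) c
  refine-refines c x y u v eq = cong proj₁ (refinementKey-≡ c x y u v eq)

  -- Every component of the key is constant on the colours of a coherent `d` below `c`. Hence
  -- refinement never becomes finer than such a `d`, which makes its limit the coarsest.
  refine-coarse : ∀ d c → IsCoherent d → Refines d c → Refines d (refine c)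
  refine-coarse d c coh ref x y u v eq = cong (Refinement.rank c)
    (cong₂ _,_ (ref x y u v eq)
      (cong₂ _,_ (ref y x v u (IsCoherent.transpose coh x y u v eq))
        (List.map-cong (λ rs → interNum-refines d c coh ref x y u v eq (proj₁ rs) (proj₂ rs)) _)))

  refine-automorphism : ∀ c g → Automorphism c g → Automorphism (refine c) g
  refine-automorphism c g aut x y = cong (Refinement.rank c)
    (cong₂ _,_ (aut x y) (cong₂ _,_ (aut y x)
      (List.map-cong (λ rs → interNum-automorphism c g aut (proj₁ rs) (proj₂ rs) x y) _)))

  quadruples : List ((Fin n × Fin n) × (Fin n × Fin n))
  quadruples = cartesianProduct pairs pairs
    where pairs = cartesianProduct (allFin n) (allFin n)

  Monochromatic : Colouring n → (Fin n × Fin n) × (Fin n × Fin n) → Set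
  Monochromatic c ((x , y) , (u , v)) = c x y ≡ c u v

  monochromatic? : ∀ c → Decidable (Monochromatic c)
  monochromatic? c ((x , y) , (u , v)) = c x y ≟ c u v

  -- The termination measure: it drops whenever a refinement step splits a colour class.
  coincidences : Colouring n → ℕ
  coincidences c = length (filter (monochromatic? c) quadruples)

  monochromatic-refine : ∀ c q → Monochromatic (refine c) q → Monochromatic c q
  monochromatic-refine c ((x , y) , (u , v)) = refine-refines c x y u v

  stable-or-finer : ∀ c → Refines c (refine c) ⊎ coincidences (refine c) < coincidences c
  stable-or-finer c with coincidences (refine c) ≟ coincidences c
  ... | no ≢ = inj₂ (≤∧≢⇒<
    (filter-⊆-≤ (monochromatic? (refine c)) (monochromatic? c) quadruples (monochromatic-refine c)) ≢)
  ... | yes eq = inj₁ λ x y u v →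
    filter-⊆-≡ (monochromatic? (refine c)) (monochromatic? c) quadruples (monochromatic-refine c) eq
      (∈-cartesianProduct⁺ (∈-cartesianProduct⁺ (∈-allFin x) (∈-allFin y))
                           (∈-cartesianProduct⁺ (∈-allFin u) (∈-allFin v)))

  stable⇒coherent : ∀ c → (∀ α β γ → c α α ≡ c β γ → β ≡ γ) → Refines c (refine c) → IsCoherent c
  stable⇒coherent c diag stable = record
    { diagonal = diag
    ; transpose = λ x y u v eq → cong (proj₁ ∘ proj₂) (key-≡ x y u v eq)
    ; intersection = λ x y u v eq → intersectionTable-≡ c (cong (proj₂ ∘ proj₂) (key-≡ x y u v eq))
    }
    where
    key-≡ : ∀ x y u v → c x y ≡ c u v → refinementKey c x y ≡ refinementKey c u v
    key-≡ x y u v eq = refinementKey-≡ c x y u v (stable x y u v eq)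

  -- Existence of the α-extension

  module _ (c : Colouring n) (coh : IsCoherent c) (α : Fin n) where

    isPoint? : ∀ x y → Dec (x ≡ α × y ≡ α)
    isPoint? x y = (x Fin.≟ α) ×-dec (y Fin.≟ α)

    module Pointed = Keyed (×-≡-dec _≟_ _≟ᵇ_) (λ x y → c x y , does (isPoint? x y))

    -- No coherence is required: this is the invariant of the refinement loop.
    record IsApproximation (d : Colouring n) : Set where
      field
        fine : Refines d Pointed.colouring
        coarse : ∀ d′ → IsPointExtensionCandidate c α d′ → Refines d′ d
        invariant : ∀ g → Automorphism c g → g ⟨$⟩ʳ α ≡ α → Automorphism d g

    pointed-approximation : IsApproximation Pointed.colouring
    pointed-approximation = record
      { fine = λ _ _ _ _ eq → eq
      ; coarse = λ d (_ , point , ref) x y u v eq → cong Pointed.rank (cong₂ _,_ (ref x y u v eq)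
          -- A candidate has (α, α) as a class of its own, so it respects the mark.
          (does-⇔ (mk⇔
            (λ p → to (point u v) (trans (sym eq) (from (point x y) p)))
            (λ p → to (point x y) (trans eq (from (point u v) p))))
            (isPoint? x y) (isPoint? u v)))
      ; invariant = λ g aut gα≡α x y → cong Pointed.rank (cong₂ _,_ (aut x y)
          (does-⇔ (mk⇔
            (λ (p , q) → unmove g gα≡α p , unmove g gα≡α q)
            (λ { (refl , refl) → gα≡α , gα≡α }))
            (isPoint? _ _) (isPoint? x y)))
      }
      where
      unmove : ∀ (g : Permutation′ n) → g ⟨$⟩ʳ α ≡ α → ∀ {x} → g ⟨$⟩ʳ x ≡ α → x ≡ α
      unmove g gα≡α gx≡α = trans (sym (flip-fixes g gx≡α)) (flip-fixes g gα≡α)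

    refine-approximation : ∀ d → IsApproximation d → IsApproximation (refine d)
    refine-approximation d app = record
      { fine = λ x y u v → fine x y u v ∘ refine-refines d x y u v
      ; coarse = λ d′ cand → refine-coarse d′ d (proj₁ cand) (coarse d′ cand)
      ; invariant = λ g aut gα≡α → refine-automorphism d g (invariant g aut gα≡α)
      }
      where open IsApproximation app

    stable-approximation : ∃ λ d → IsApproximation d × Refines d (refine d)
    stable-approximation = go Pointed.colouring pointed-approximation (<-wellFounded _)
      where
      go : ∀ d → IsApproximation d → Acc _<_ (coincidences d) →
           ∃ λ d → IsApproximation d × Refines d (refine d)
      go d app (acc rec) with stable-or-finer d
      ... | inj₁ stable = d , app , stable
      ... | inj₂ finer = go (refine d) (refine-approximation d app) (rec finer)

    -- The hypothesis of the theorem speaks of every α-extension, so one must be constructed before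
    -- it can be applied. The last component lets automorphisms of `c` fixing α act on the
    -- extension.
    α-extension : ∃ λ d → IsAlphaExtension c α d ×
      (∀ g → Automorphism c g → g ⟨$⟩ʳ α ≡ α → Automorphism d g)
    α-extension with stable-approximation
    ... | d , app , stable =
      d , ((stable⇒coherent d diag stable , point , ref) , coarse) , invariant
      where
      open IsApproximation app
      key-≡ : ∀ x y u v → d x y ≡ d u v →
        (c x y , does (isPoint? x y)) ≡ (c u v , does (isPoint? u v))
      key-≡ x y u v eq = Pointed.colouring-injective x y u v (fine x y u v eq)
      ref : Refines d c
      ref x y u v eq = cong proj₁ (key-≡ x y u v eq)
      diag : ∀ β γ δ → d β β ≡ d γ δ → γ ≡ δ
      diag β γ δ eq = IsCoherent.diagonal coh β γ δ (ref β β γ δ eq)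
      isPoint : ∀ x y → d x y ≡ d α α → x ≡ α × y ≡ α
      -- Equal colours carry equal marks, and the mark of (α, α) is true.
      isPoint x y eq = invert (subst (Reflects _)
        (trans (cong proj₂ (key-≡ x y α α eq)) (dec-true (isPoint? α α) (refl , refl)))
        (proof (isPoint? x y)))
      point : ∀ x y → (d x y ≡ d α α) ⇔ (x ≡ α × y ≡ α)
      point x y = mk⇔ (isPoint x y) (λ { (refl , refl) → refl })

  -- Triangles and fibers in a coherent configuration

  module Coherent {c : Colouring n} (coh : IsCoherent c) where
    open IsCoherent coh

    -- `z` makes an intersection number at (`x`, `y`) positive; the same number at (`u`, `v`) is
    -- then positive and supplies `w`.
    triangle : ∀ {x y u v} → c x y ≡ c u v → ∀ z → ∃ λ w → c u w ≡ c x z × c w v ≡ c z y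
    triangle {x} {y} {u} {v} eq z with filter-nonempty
      (λ w → (c u w ≟ c x z) ×-dec (c w v ≟ c z y)) (allFin n)
      (subst (0 <_) (intersection x y u v eq (c x z) (c z y))
        (List.filter-some _ (Any.map (λ { refl → refl , refl }) (∈-allFin z))))
    ... | w , _ , p = w , p

    -- Take the triangle with third point `x`: its copy `w` is joined to `u` by a diagonal colour,
    -- so it is `u`.
    source : ∀ {x y u v} → c x y ≡ c u v → c x x ≡ c u u
    source {x} {y} {u} eq with triangle eq x
    ... | w , cuw≡cxx , _ with diagonal x u w (sym cuw≡cxx)
    ... | refl = sym cuw≡cxx

    target : ∀ {x y u v} → c x y ≡ c u v → c y y ≡ c v v
    target {x} {y} {u} {v} eq = source (transpose x y u v eq)

  valency : Colouring n → Fin n → ℕ → ℕ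
  valency c α r = length (filter (λ z → c α z ≟ r) (allFin n))

  -- Automorphisms fixing a point

  module SemiregularExtension {c d : Colouring n} {α : Fin n}
    (cand : IsPointExtensionCandidate c α d)
    (semireg : SemiregularOff d α) (fibers : FibersAreNeighbourhoods c α d) where

    open Coherent (proj₁ cand)
    open IsCoherent (proj₁ cand)

    isPoint : ∀ {x y} → d x y ≡ d α α → x ≡ α × y ≡ α
    isPoint {x} {y} = to (proj₁ (proj₂ cand) x y)

    -- Semiregularity covers only relations that avoid α. If `β₁` is α, uniqueness holds because {α}
    -- is a fiber; otherwise the source and target fibers of the relation both avoid α.
    neighbour-unique : ∀ {β β₁ β₂} → β ≢ α → d β β₂ ≡ d β β₁ → β₁ ≡ β₂
    neighbour-unique {β} {β₁} {β₂} β≢α eq with β₁ Fin.≟ α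
    ... | yes refl = sym (proj₁ (isPoint (target eq)))
    ... | no β₁≢α = semireg β β₁ β₂
      (λ x y e → (λ { refl → β≢α (proj₁ (isPoint (sym (source e)))) })
               , (λ { refl → β₁≢α (proj₁ (isPoint (sym (target e)))) }))
      β≢α eq

    transport : ∀ {β β′} → d β β ≡ d β′ β′ → Fin n → Fin n
    transport eq γ = proj₁ (triangle eq γ)

    transport-spec : ∀ {β β′} (eq : d β β ≡ d β′ β′) γ → d β′ (transport eq γ) ≡ d β γ
    transport-spec eq γ = proj₁ (proj₂ (triangle eq γ))

    -- Copy the triangle on `β`, `y`, `x` to the base from `β′` to the image of `y`. Its third
    -- vertex has the right colour from `β′`, so by uniqueness it is the image of `x`.
    transport-preserves : ∀ {β β′} (eq : d β β ≡ d β′ β′) → β′ ≢ α → ∀ x y →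
      d (transport eq x) (transport eq y) ≡ d x y
    transport-preserves {β} {β′} eq β′≢α x y with triangle (sym (transport-spec eq y)) x
    ... | w , p , q with neighbour-unique β′≢α (trans p (sym (transport-spec eq x)))
    ... | refl = q

    transport-inverse : ∀ {β β′} (eq : d β β ≡ d β′ β′) (eq′ : d β′ β′ ≡ d β β) → β ≢ α →
      ∀ γ → transport eq′ (transport eq γ) ≡ γ
    transport-inverse eq eq′ β≢α γ = sym (neighbour-unique β≢α
      (trans (transport-spec eq′ (transport eq γ)) (transport-spec eq γ)))

    transport-fixes : ∀ {β β′} (eq : d β β ≡ d β′ β′) → transport eq α ≡ α
    transport-fixes eq = proj₁ (isPoint (sym (target (sym (transport-spec eq α)))))

    -- Points in one αs lie in one fiber of `d`, so transport from `β` to `β′` is available, with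
    -- the reverse transport as inverse. It preserves `d`, hence the coarser `c`.
    point-stabiliser-transitive : ∀ {β β′} → β ≢ α → β′ ≢ α → c α β ≡ c α β′ →
      ∃ λ g → Automorphism c g × g ⟨$⟩ʳ α ≡ α × g ⟨$⟩ʳ β ≡ β′
    point-stabiliser-transitive {β} {β′} β≢α β′≢α eq =
        permutation (transport dβ≡dβ′) (transport (sym dβ≡dβ′))
          (transport-inverse _ _ β′≢α) (transport-inverse _ _ β≢α)
      , (λ x y → proj₂ (proj₂ cand) _ _ _ _ (transport-preserves dβ≡dβ′ β′≢α x y))
      , transport-fixes dβ≡dβ′
      , sym (neighbour-unique β′≢α (trans (transport-spec dβ≡dβ′ β) dβ≡dβ′))
      where
      dβ≡dβ′ : d β β ≡ d β′ β′
      dβ≡dβ′ = from (fibers β β′) eq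

    -- Once β is fixed, `x` and its image are neighbours of β of the same colour, so they coincide.
    two-point-stabiliser-trivial : ∀ g → Automorphism d g → ∀ {β} → β ≢ α →
      g ⟨$⟩ʳ β ≡ β → FixesAll g
    two-point-stabiliser-trivial g aut {β} β≢α gβ≡β x = sym (neighbour-unique β≢α
      (trans (cong (λ b → d b (g ⟨$⟩ʳ x)) (sym gβ≡β)) (aut β x)))

    -- The relation of (`x`, `y`) in `d` matches the two neighbourhoods: triangles give each `z` a
    -- partner `w`, and uniqueness for the transposed relation recovers `z` from `w`.
    valency-≤ : ∀ {x y} → x ≢ α → y ≢ α → valency c α (c α x) ≤ valency c α (c α y)
    valency-≤ {x} {y} x≢α y≢α = count-≤ _ _ (λ z w → d z w ≡ d x y)
      (λ {z} {z′} {w} e e′ → neighbour-unique (notPoint e)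
        (transpose z′ w z w (trans e′ (sym e))))
      (λ z cz≡cx → let dz≡dx = from (fibers z x) cz≡cx
                       w , p , _ = triangle (sym dz≡dx) y
                   in w , to (fibers w y) (sym (target (sym p))) , p)
      where
      notPoint : ∀ {z w} → d z w ≡ d x y → w ≢ α
      notPoint e refl = y≢α (proj₁ (isPoint (sym (target e))))

  -- The automorphism group and its orbits

  module _ (c : Colouring n) where

    Reachable : Fin n → Fin n → Set
    Reachable α β = ∃ λ g → Automorphism c g × g ⟨$⟩ʳ α ≡ β

    IsAutomorphismPair : Fin n → Fin n → (Fin n → Fin n) → (Fin n → Fin n) → Set
    IsAutomorphismPair α β f h =
      (∀ x → f (h x) ≡ x) × (∀ x → h (f x) ≡ x) × (∀ x y → c (f x) (f y) ≡ c x y) × f α ≡ β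

    isAutomorphismPair? : ∀ α β f h → Dec (IsAutomorphismPair α β f h)
    isAutomorphismPair? α β f h =
      Fin.all? (λ x → f (h x) Fin.≟ x) ×-dec Fin.all? (λ x → h (f x) Fin.≟ x) ×-dec
      Fin.all? (λ x → Fin.all? (λ y → c (f x) (f y) ≟ c x y)) ×-dec (f α Fin.≟ β)

    -- Orbits have to be decidable in order to be counted. The search runs over codes of pairs of
    -- functions, a permutation being a function together with its inverse.
    reachable? : ∀ α β → Dec (Reachable α β)
    reachable? α β = map′ decode encode
      (Fin.any? λ i → Fin.any? λ j → isAutomorphismPair? α β (finToFun i) (finToFun j))
      where
      decode : (∃₂ λ i j → IsAutomorphismPair α β (finToFun i) (finToFun j)) → Reachable α β
      decode (i , j , fh , hf , aut , fα≡β) = permutation (finToFun i) (finToFun j) fh hf , aut , fα≡β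
      encode : Reachable α β → ∃₂ λ i j → IsAutomorphismPair α β (finToFun i) (finToFun j)
      encode (g , aut , gα≡β) =
          funToFin (g ⟨$⟩ʳ_) , funToFin (g ⟨$⟩ˡ_)
        , (λ x → trans (f≗ _) (trans (cong (g ⟨$⟩ʳ_) (h≗ x)) (inverseʳ g)))
        , (λ x → trans (h≗ _) (trans (cong (g ⟨$⟩ˡ_) (f≗ x)) (inverseˡ g)))
        , (λ x y → trans (cong₂ c (f≗ x) (f≗ y)) (aut x y))
        , trans (f≗ α) gα≡β
        where
        f≗ = Fin.finToFun-funToFin (g ⟨$⟩ʳ_)
        h≗ = Fin.finToFun-funToFin (g ⟨$⟩ˡ_)

    automorphism-group : IsPermGroup (Automorphism c)
    automorphism-group = record
      { has-id = λ _ _ → refl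
      ; closed-∘ = λ g h aut-g aut-h x y →
          trans (aut-h (g ⟨$⟩ʳ x) (g ⟨$⟩ʳ y)) (aut-g x y)
      ; closed-inv = flip-automorphism
      }

  -- Transitivity of the automorphism group

  module _ {c : Colouring n} (scheme : IsScheme c)
    (hyp : ∀ (α : Fin n) (d : Colouring n) → IsAlphaExtension c α d →
           SemiregularOff d α × FibersAreNeighbourhoods c α d) where

    open IsScheme scheme
    open IsCoherent coherent
    open Coherent coherent

    module Stab (α : Fin n) where
      ext = α-extension c coherent α
      isExt = proj₁ (proj₂ ext)
      inv = proj₂ (proj₂ ext)
      open SemiregularExtension (proj₁ isExt)
        (proj₁ (hyp α (proj₁ ext) isExt)) (proj₂ (hyp α (proj₁ ext) isExt)) public

    off-diagonal : ∀ {α β γ δ} → c α β ≡ c γ δ → β ≢ α → δ ≢ γ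
    off-diagonal {α} {β} {γ} eq β≢α refl = β≢α (sym (diagonal γ α β (sym eq)))

    stabiliser-transitive : ∀ α {β β′} → c α β ≡ c α β′ →
      ∃ λ g → Automorphism c g × g ⟨$⟩ʳ α ≡ α × g ⟨$⟩ʳ β ≡ β′
    stabiliser-transitive α {β} {β′} eq with β Fin.≟ α
    -- The colour is diagonal here, so `β′` is α as well and the identity serves.
    ... | yes refl = id , (λ _ _ → refl) , refl , diagonal α α β′ eq
    ... | no β≢α = Stab.point-stabiliser-transitive α β≢α (off-diagonal eq β≢α) eq

    valency-≡ : ∀ {α x y} → x ≢ α → y ≢ α → valency c α (c α x) ≡ valency c α (c α y)
    valency-≡ {α} x≢α y≢α = ≤-antisym (Stab.valency-≤ α x≢α y≢α) (Stab.valency-≤ α y≢α x≢α)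

    -- A valency is an intersection number at a diagonal pair, the way back having the transposed
    -- colour automatically. All diagonal pairs of a scheme share one colour, so valencies do not
    -- depend on the point.
    valency-via-interNum : ∀ α u v → valency c α (c u v) ≡ interNum c (c u v) (c v u) α α
    valency-via-interNum α u v = cong length (List.filter-≐ _ _
      ((λ {z} e → e , transpose α z u v e) , proj₁) (allFin n))

    valency-homogeneous : ∀ α β u v → valency c α (c u v) ≡ valency c β (c u v)
    valency-homogeneous α β u v = trans (valency-via-interNum α u v)
      (trans (intersection α α β β (reflexive α β) (c u v) (c v u)) (sym (valency-via-interNum β u v)))

    -- The non-regular case

    module NonRegular (ω ω₁ ω₂ : Fin n) (same : c ω ω₁ ≡ c ω ω₂) (ω₁≢ω₂ : ω₁ ≢ ω₂) where

      ω₁≢ω : ω₁ ≢ ω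
      ω₁≢ω refl = ω₁≢ω₂ (diagonal ω ω ω₂ same)

      k : ℕ
      k = valency c ω (c ω ω₁)

      k≢1 : k ≢ 1
      -- `ω₁` and `ω₂` are two distinct points among those counted by `k`.
      k≢1 k≡1 with subst (2 ≤_) k≡1 (length-≤-by-injection _≡_ (λ { refl refl → refl }) {ω₁ ∷ ω₂ ∷ []}
        ((ω₁≢ω₂ All.∷ All.[]) ∷ All.[] ∷ [])
        (λ { (here refl) → ω₁ , ∈-filter⁺ (λ z → c ω z ≟ c ω ω₁) (∈-allFin ω₁) refl , refl
           ; (there (here refl)) → ω₂ , ∈-filter⁺ (λ z → c ω z ≟ c ω ω₁) (∈-allFin ω₂) (sym same) , refl }))
      ... | s≤s ()

      -- The colour of (`α`, `x`) also occurs at `ω`, off the diagonal, and there all such valencies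
      -- agree.
      valency≡k : ∀ {α x} → x ≢ α → valency c α (c α x) ≡ k
      valency≡k {α} {x} x≢α with triangle (reflexive α ω) x
      ... | w , cωw≡cαx , _ = trans (valency-homogeneous α ω α x)
        (trans (cong (valency c ω) (sym cωw≡cαx))
          (valency-≡ (off-diagonal (sym cωw≡cαx) x≢α) ω₁≢ω))

      -- `X` is a union of sets βs; since it misses `β`, each of them has size `k`.
      ∣-closed : ∀ β {X : Fin n → Set} (X? : Decidable X) → ¬ X β →
        (∀ x y → X x → c β y ≡ c β x → X y) → k ∣ length (filter X? (allFin n))
      ∣-closed β X? β∉X closed = ∣-length-of-classes (c β) k _ λ x x∈ →
        let Xx = proj₂ (∈-filter⁻ X? {xs = allFin n} x∈) in
        trans (cong length (filter-absorb (λ y → c β y ≟ c β x) X? (allFin n)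
                (λ y → closed x y Xx)))
              (valency≡k (λ { refl → β∉X Xx }))

      -- An automorphism fixing `β` moves `x` to `y`, so they share an orbit. `β` is arbitrary, so
      -- one orbit can be counted from a point outside it and from a point of it.
      reachable-closed : ∀ α β x y → Reachable c α x → c β y ≡ c β x → Reachable c α y
      reachable-closed α β x y (g , aut , gα≡x) eq with stabiliser-transitive β (sym eq)
      ... | h , aut′ , _ , hx≡y =
        g ∘ₚ h , IsPermGroup.closed-∘ (automorphism-group c) g h aut aut′
               , trans (cong (h ⟨$⟩ʳ_) gα≡x) hx≡y

      transitive : ∀ α β → Reachable c α β
      transitive α β = decidable-stable (reachable? c α β) λ β∉O →
        let
          O? = reachable? c α
          punctured? = λ x → ¬? (x Fin.≟ α) ×-dec O? x
          all = allFin n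
          k∣O = ∣-closed β O? β∉O (reachable-closed α β)
          k∣O∖α = ∣-closed α punctured? (λ (α≢α , _) → α≢α refl)
            (λ x y (x≢α , x∈O) eq → off-diagonal (sym eq) x≢α , reachable-closed α α x y x∈O eq)
          point? = λ x → x Fin.≟ α
          O = filter O? all
          one : length (filter point? O) ≡ 1
          one = ≤-antisym
            (length-≤-by-injection _≡_ (λ { refl refl → refl }) {ys = α ∷ []}
              (filter⁺ point? (filter⁺ O? (allFin⁺ n)))
              (λ x∈ → α , here refl , proj₂ (∈-filter⁻ point? {xs = O} x∈)))
            (length-≤-by-injection _≡_ (λ { refl refl → refl }) {xs = α ∷ []} (All.[] ∷ [])
              (λ { (here refl) → α , ∈-filter⁺ point?
                     (∈-filter⁺ O? (∈-allFin α) (id , (λ _ _ → refl) , refl)) refl , refl }))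
          rest : length (filter (λ x → ¬? (point? x)) O) ≡ length (filter punctured? all)
          rest = cong length (filter-filter (λ x → ¬? (point? x)) O? all)
        -- The orbit has one point more than the punctured orbit; `k` divides both sizes, hence 1.
        in k≢1 (∣1⇒≡1 (∣m+n∣m⇒∣n
             (subst (k ∣_) (trans (sym (length-filter-split point? O))
               (trans (+-comm (length (filter point? O)) _) (cong₂ _+_ rest one))) k∣O) k∣O∖α))

      frobenius : IsFrobeniusScheme c
      frobenius = Automorphism c , record
        { group = automorphism-group c
        ; transitive = transitive
        ; nonRegular = λ stabilisers-trivial →
            -- An automorphism fixing `ω` and moving `ω₁` to `ω₂` witnesses a nontrivial stabiliser.
            let g , aut , gω≡ω , gω₁≡ω₂ = stabiliser-transitive ω same in
            ω₁≢ω₂ (trans (sym (stabilisers-trivial g aut ω gω≡ω ω₁)) gω₁≡ω₂)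
        ; twoPoint = λ g aut α β α≢β gα≡α gβ≡β →
            Stab.two-point-stabiliser-trivial α g (Stab.inv α g aut gα≡α) (α≢β ∘ sym) gβ≡β
        } , λ x y u v → mk⇔ (orbital x y u v) λ { (g , aut , refl , refl) → sym (aut x y) }
        where
        -- First move `x` to `u` by transitivity; then the image of `y` and `v` have the same colour
        -- from `u`, and the stabiliser of `u` joins them.
        orbital : ∀ x y u v → c x y ≡ c u v →
          ∃ λ g → Automorphism c g × g ⟨$⟩ʳ x ≡ u × g ⟨$⟩ʳ y ≡ v
        orbital x y u v eq =
          let g , aut , gx≡u = transitive x u
              h , aut′ , hu≡u , hgy≡v = stabiliser-transitive u
                (trans (cong (λ w → c w (g ⟨$⟩ʳ y)) (sym gx≡u)) (trans (aut x y) eq))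
          in g ∘ₚ h , IsPermGroup.closed-∘ (automorphism-group c) g h aut aut′
                    , trans (cong (h ⟨$⟩ʳ_) gx≡u) hu≡u , hgy≡v

theorem6p1 : (n : ℕ) (c : Colouring n) → IsScheme c →
    (∀ (α : Fin n) (c′ : Colouring n) → IsAlphaExtension c α c′ →
    SemiregularOff c′ α × FibersAreNeighbourhoods c α c′) →
    IsRegularScheme c ⊎ IsFrobeniusScheme c
theorem6p1 n c scheme hyp
  with Fin.any? (λ α → Fin.any? (λ β → Fin.any? (λ γ → (c α β ≟ c α γ) ×-dec ¬? (β Fin.≟ γ))))
... | yes (α , β , γ , same , β≢γ) =
  inj₂ (NonRegular.frobenius scheme hyp α β γ same β≢γ)
... | no ¬witness = inj₁ (scheme , λ α β γ same →
  decidable-stable (β Fin.≟ γ) (λ β≢γ → ¬witness (α , β , γ , same , β≢γ)))
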